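{- Let $\Sigma^\nabla$ be an intersection-type theory which is natural or strict. Then for all $\nabla$-bases $\Gamma$, all $\lambda$-terms $M$ and all types $A\in\mathsf{T}^\nabla$: if $\Gamma\models^\nabla_i M:A$ (satisfiability in the inference semantics), then $\Gamma\vdash^\nabla M:A$ is derivable.
   Context: **Types and theories.** Given a set $\mathsf{C}$ of type constants, $\mathsf{T}(\mathsf{C})$ is generated by $\mathsf{T}=\mathsf{C}\mid \mathsf{T}\to\mathsf{T}\mid\mathsf{T}\cap\mathsf{T}$. Let $\nabla^0$ consist of the axioms $A\le A$; $A\le A\cap A$; $A\cap B\le A$; $A\cap B\le B$; and the rules: $A\le A'$, $B\le B'$ imply $A\cap B\le A'\cap B'$; $A\le B$, $B\le C$ imply $A\le C$. Given a collection $\nabla$ of further axioms and rules for judgments $A\le B$ over $\mathsf{T}(\mathsf{C})$, the intersection-type theory $\Sigma^\nabla=\Sigma(\mathsf{C},\nabla)$ is the set of judgments $A\le B$ derivable from $\nabla^0\cup\nabla$. Write $\mathsf{C}^\nabla=\mathsf{C}$, $\mathsf{T}^\nabla=\mathsf{T}(\mathsf{C})$, $A\le_\nabla B$ for $(A\le B)\in\Sigma^\nabla$, and $A\sim_\nabla B$ for $A\le_\nabla B\le_\nabla A$. $\Sigma^\nabla$ *validates* a collection of axioms and rules if all of them are admissible in $\Sigma^\nabla$. There are two special constants $\Omega,\nu$. Standing assumptions: $\Omega$ and $\nu$ are not both in $\mathsf{C}^\nabla$; if $\Omega\in\mathsf{C}^\nabla$ then $\nabla$ contains the axiom $(\Omega)$: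 $A\le\Omega$; if $\nu\in\mathsf{C}^\nabla$ then $\nabla$ contains the axiom $(\nu)$: $A\to B\le\nu$. Axioms and rules: ($\to$-$\cap$): $(A\to B)\cap(A\to C)\le A\to B\cap C$ (here $\cap$ binds tighter than $\to$); ($\eta$): $A'\le A$ and $B\le B'$ imply $A\to B\le A'\to B'$; ($\Omega$-lazy): $A\to B\le\Omega\to\Omega$. $\Sigma^\nabla$ is *strict* if $\Omega\notin\mathsf{C}^\nabla$ and it validates ($\to$-$\cap$) and ($\eta$). $\Sigma^\nabla$ is *natural* if $\Omega\in\mathsf{C}^\nabla$ and it validates ($\to$-$\cap$), ($\eta$), ($\Omega$) and ($\Omega$-lazy). **Type assignment.** A $\nabla$-basis $\Gamma$ is a set of statements $x:B$ with $x$ a term variable and $B\in\mathsf{T}^\nabla$, all of whose variables are distinct. Judgments $\Gamma\vdash^\nabla M:A$ ($M$ an untyped $\lambda$-term, $A\in\mathsf{T}^\nabla$) are derived by: (Ax) $\Gamma\vdash^\nabla x:A$ if $(x:A)\in\Gamma$; ($\to$I) from $\Gamma,x:A\vdash^\nabla M:B$ infer $\Gamma\vdash^\nabla\lambda x.M:A\to B$; ($\to$E) from $\Gamma\vdash^\nabla M:A\to B$ and $\Gamma\vdash^\nabla N:A$ infer $\Gamma\vdash^\nabla MN:B$; ($\cap$I) from $\Gamma\vdash^\nabla M:A$ and $\Gamma\vdash^\nabla M:B$ infer $\Gamma\vdash^\nabla M:A\cap B$; ($\le_\nabla$) from $\Gamma\vdash^\nabla M:A$ and $A\le_\nabla B$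 infer $\Gamma\vdash^\nabla M:B$; moreover, if $\Omega\in\mathsf{C}^\nabla$, (Ax-$\Omega$) $\Gamma\vdash^\nabla M:\Omega$ for every $M$; if $\nu\in\mathsf{C}^\nabla$, (Ax-$\nu$) $\Gamma\vdash^\nabla\lambda x.M:\nu$ for every $x,M$. **Semantics.** Let $\Lambda$ be the set of $\lambda$-terms and $\mathrm{Var}$ the set of term variables. A *$\lambda$-applicative structure* is a triple $\langle\mathcal D,\cdot,[\![\;]\!]^{\mathcal D}\rangle$ where $\langle\mathcal D,\cdot\rangle$ is an applicative structure (a set with a binary operation) and $[\![\;]\!]^{\mathcal D}:\Lambda\times(\mathrm{Var}\to\mathcal D)\to\mathcal D$, $(M,\rho)\mapsto[\![M]\!]^{\mathcal D}_\rho$, is an interpretation function for $\lambda$-terms. A *type interpretation domain* is $\mathcal I=\langle\mathcal D,\cdot,[\![\;]\!]^{\mathcal D},\Phi\rangle$ where $\langle\mathcal D,\cdot,[\![\;]\!]^{\mathcal D}\rangle$ is a $\lambda$-applicative structure and $\Phi\subseteq\mathcal D$ satisfies $[\![\lambda x.M]\!]^{\mathcal D}_\rho\in\Phi$ for all $x,M,\rho$. Given a type environment $\mathcal V:\mathsf{C}^\nabla\to\mathsf P(\mathcal D)$ ($\mathsf P$ = powerset), put $[\![\Omega]\!]^{\mathcal I}_{\mathcal V}=\mathcal D$; $[\![\nu]\!]^{\mathcal I}_{\mathcal V}=\Phi$; $[\![\psi]\!]^{\mathcal I}_{\mathcal V}=\mathcal V(\psi)$ for other constants $\psi$; $[\![A\to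 B]\!]^{\mathcal I}_{\mathcal V}=\{X\in\Phi\mid\forall Y\in[\![A]\!]^{\mathcal I}_{\mathcal V}.\ X\cdot Y\in[\![B]\!]^{\mathcal I}_{\mathcal V}\}$; $[\![A\cap B]\!]^{\mathcal I}_{\mathcal V}=[\![A]\!]^{\mathcal I}_{\mathcal V}\cap[\![B]\!]^{\mathcal I}_{\mathcal V}$. A term environment $\rho:\mathrm{Var}\to\mathcal D$ is *good* if $[\![x]\!]^{\mathcal D}_\rho=\rho(x)$ for all $x\in\mathrm{Var}$ and there are terms $M,N$ with $[\![M]\!]^{\mathcal D}_\rho\ne[\![N]\!]^{\mathcal D}_\rho$. The pair $\mathcal I,\mathcal V$ is *$\nabla$-good* if for all $A,B\in\mathsf{T}^\nabla$: (a) for all good $\rho$, all variables $x$ and all $d\in[\![A]\!]^{\mathcal I}_{\mathcal V}$, $\rho[x:=d]$ is good; (b) for all good $\rho$, terms $M$, variables $x$: if $[\![M]\!]^{\mathcal D}_{\rho[x:=d]}\in[\![B]\!]^{\mathcal I}_{\mathcal V}$ for all $d\in[\![A]\!]^{\mathcal I}_{\mathcal V}$, then $[\![\lambda x.M]\!]^{\mathcal D}_\rho\in[\![A\to B]\!]^{\mathcal I}_{\mathcal V}$. The pair *agrees* with $\Sigma^\nabla$ if $A\le_\nabla B$ implies $[\![A]\!]^{\mathcal I}_{\mathcal V}\subseteq[\![B]\!]^{\mathcal I}_{\mathcal V}$ for all $A,B\in\mathsf{T}^\nabla$. Write $\mathcal I,\rho,\mathcal V\models M:A$ iff $[\![M]\!]^{\mathcal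 D}_\rho\in[\![A]\!]^{\mathcal I}_{\mathcal V}$, and $\mathcal I,\rho,\mathcal V\models\Gamma$ iff $\mathcal I,\rho,\mathcal V\models x:B$ for all $(x:B)\in\Gamma$. *Inference semantics*: $\Gamma\models^\nabla_i M:A$ iff for all $\nabla$-good pairs $\mathcal I,\mathcal V$ which agree with $\Sigma^\nabla$, and all good term environments $\rho$, $\mathcal I,\rho,\mathcal V\models\Gamma$ implies $\mathcal I,\rho,\mathcal V\models M:A$. -}

module Defs where

open import Algebra.Bundles using (Magma)
open import Data.Fin.Base using (Fin; fromℕ; inject₁)
open import Data.List.Base using (List; []; _∷_)
open import Data.List.Relation.Unary.All using (All)
open import Data.Nat.Base using (ℕ; zero; suc)
open import Data.Nat.Properties using (_≟_)
open import Data.Product.Base using (_×_; _,_; Σ-syntax; ∃-syntax; proj₁)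
open import Data.Sum.Base using (_⊎_; inj₁; inj₂)
open import Level using (Level) renaming (suc to lsuc)
open import Relation.Binary.Definitions using (_Respects_)
open import Relation.Binary.PropositionalEquality.Core using (_≡_; _≢_; trans; sym)
open import Relation.Nullary using (¬_; yes; no; contradiction)
open import Relation.Unary using (Pred; _∈_; _∉_; _⊆_; _∩_)
open import Relation.Unary.Polymorphic using (U)

private
  variable
    ℓ : Level
    n : ℕ

------------------------------------------------------------------------
-- Untyped λ-terms, up to α-conversion

Var : Set
Var = ℕ

-- Locally nameless: free variables are names, bound variables are
-- well-scoped de Bruijn indices.  Thus α-equivalence is _≡_.

data Term (n : ℕ) : Set where
  free  : Var → Term n
  bound : Fin n → Term n
  app   : Term n → Term n → Term n
  lam   : Term (suc n) → Term n

Λ : Set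
Λ = Term zero

-- `close x M` turns the free occurrences of x in M into references to
-- one new binder outside all the others, i.e. to the largest index.

close : Var → Term n → Term (suc n)
close {n} x (free y) with x ≟ y
... | yes _ = bound (fromℕ n)
... | no  _ = free y
close x (bound i) = bound (inject₁ i)
close x (app M N) = app (close x M) (close x N)
close x (lam M)   = lam (close x M)

-- The abstraction λx.M of a term M with respect to a named variable x.
-- Every `lam N` in Λ is of this form, for any x not free in N.

ƛ : Var → Λ → Λ
ƛ x M = lam (close x M)

------------------------------------------------------------------------
-- Intersection types and intersection-type theories

-- Ψ provides the constants other than the two special ones.

data Constant (Ψ : Set ℓ) : Set ℓ where
  Ω ν : Constant Ψ
  ψ   : Ψ → Constant Ψ

infixr 7 _⇒_
infixr 8 _∧_

-- T(C).  The membership proof is irrelevant, so that C behaves as a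
-- set: two occurrences of the same constant are the same type.

data Type {Ψ : Set ℓ} (C : Pred (Constant Ψ) ℓ) : Set ℓ where
  con : (c : Constant Ψ) → .(c ∈ C) → Type C
  _⇒_ : Type C → Type C → Type C
  _∧_ : Type C → Type C → Type C

module _ {Ψ : Set ℓ} (C : Pred (Constant Ψ) ℓ) where

  infix 4 _≤_

  record Judgment : Set ℓ where
    constructor _≤_
    field
      lhs rhs : Type C

  -- A collection of axioms and rules, given by all their instances:
  -- `R ps j` says that j may be inferred from the list of premises ps.
  -- The instances with ps = [] are the axioms.

  Rules : Set (lsuc ℓ)
  Rules = List Judgment → Judgment → Set ℓ

module _ {Ψ : Set ℓ} {C : Pred (Constant Ψ) ℓ} where

  data ∇⁰ : Rules C where
    ≤-refl  : ∀ {A}     → ∇⁰ [] (A ≤ A)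
    ≤-idem  : ∀ {A}     → ∇⁰ [] (A ≤ A ∧ A)
    ∧-inclˡ : ∀ {A B}   → ∇⁰ [] (A ∧ B ≤ A)
    ∧-inclʳ : ∀ {A B}   → ∇⁰ [] (A ∧ B ≤ B)
    ∧-mono  : ∀ {A A′ B B′} →
              ∇⁰ ((A ≤ A′) ∷ (B ≤ B′) ∷ []) (A ∧ B ≤ A′ ∧ B′)
    ≤-trans : ∀ {A B D} → ∇⁰ ((A ≤ B) ∷ (B ≤ D) ∷ []) (A ≤ D)

  data →-∩-axiom : Rules C where
    →-∩ : ∀ {A B D} → →-∩-axiom [] ((A ⇒ B) ∧ (A ⇒ D) ≤ A ⇒ (B ∧ D))

  data η-rule : Rules C where
    η : ∀ {A A′ B B′} →
        η-rule ((A′ ≤ A) ∷ (B ≤ B′) ∷ []) (A ⇒ B ≤ A′ ⇒ B′)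

  data Ω-axiom .(p : Ω ∈ C) : Rules C where
    Ω-top : ∀ {A} → Ω-axiom p [] (A ≤ con Ω p)

  data Ω-lazy-axiom .(p : Ω ∈ C) : Rules C where
    Ω-lazy : ∀ {A B} →
             Ω-lazy-axiom p [] (A ⇒ B ≤ con Ω p ⇒ con Ω p)

  data ν-axiom .(p : ν ∈ C) : Rules C where
    ν-top : ∀ {A B} → ν-axiom p [] (A ⇒ B ≤ con ν p)

  Contains : Rules C → Rules C → Set ℓ
  Contains ∇ R = ∀ {ps j} → R ps j → ∇ ps j

  data Derivable (∇ : Rules C) : Judgment C → Set ℓ where
    infer : ∀ {ps j} → ∇⁰ ps j ⊎ ∇ ps j →
            All (Derivable ∇) ps → Derivable ∇ j

record TypeTheory ℓ : Set (lsuc ℓ) where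
  field
    Ψ  : Set ℓ
    C  : Pred (Constant Ψ) ℓ
    ∇  : Rules C

    not-both   : ¬ (Ω ∈ C × ν ∈ C)
    contains-Ω : .(p : Ω ∈ C) → Contains ∇ (Ω-axiom p)
    contains-ν : .(p : ν ∈ C) → Contains ∇ (ν-axiom p)

  T : Set ℓ
  T = Type C

  Σ∇ : Pred (Judgment C) ℓ
  Σ∇ = Derivable ∇

  infix 4 _≤∇_

  _≤∇_ : T → T → Set ℓ
  A ≤∇ B = (A ≤ B) ∈ Σ∇

  Validates : Rules C → Set ℓ
  Validates R = ∀ {ps j} → R ps j → All (_∈ Σ∇) ps → j ∈ Σ∇

module _ (Θ : TypeTheory ℓ) where
  open TypeTheory Θ

  record Strict : Set ℓ where
    field
      Ω∉C           : Ω ∉ C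
      validates-→-∩ : Validates →-∩-axiom
      validates-η   : Validates η-rule

  record Natural : Set ℓ where
    field
      Ω∈C              : Ω ∈ C
      validates-→-∩    : Validates →-∩-axiom
      validates-η      : Validates η-rule
      validates-Ω      : Validates (Ω-axiom Ω∈C)
      validates-Ω-lazy : Validates (Ω-lazy-axiom Ω∈C)

------------------------------------------------------------------------
-- Bases and type assignment

module _ (Θ : TypeTheory ℓ) where
  open TypeTheory Θ

  -- A possibly infinite set of statements x : A with distinct variables.

  record Basis : Set (lsuc ℓ) where
    field
      statements : Pred (Var × T) ℓ
      distinct   : ∀ {x A B} → (x , A) ∈ statements →
                   (x , B) ∈ statements → A ≡ B

module _ {Θ : TypeTheory ℓ} where
  open TypeTheory Θ
  open Basis

  infix  4 _∶_∈ᴮ_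
  infixl 5 _,_∶_

  _∶_∈ᴮ_ : Var → T → Basis Θ → Set ℓ
  x ∶ A ∈ᴮ Γ = (x , A) ∈ statements Γ

  -- Γ , x : A; a statement about x in Γ, if there is one, is replaced.
  -- As terms are taken up to α-conversion and Γ may mention all
  -- variables, x cannot be required to be fresh for Γ.

  _,_∶_ : Basis Θ → Var → T → Basis Θ
  (Γ , x ∶ A) .statements (y , B) =
    (y ≡ x × B ≡ A) ⊎ (y ≢ x × y ∶ B ∈ᴮ Γ)
  (Γ , x ∶ A) .distinct (inj₁ (_ , p))   (inj₁ (_ , q))   = trans p (sym q)
  (Γ , x ∶ A) .distinct (inj₁ (p , _))   (inj₂ (y≢x , _)) = contradiction p y≢x
  (Γ , x ∶ A) .distinct (inj₂ (y≢x , _)) (inj₁ (q , _))   = contradiction q y≢x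
  (Γ , x ∶ A) .distinct (inj₂ (_ , p))   (inj₂ (_ , q))   = distinct Γ p q

infix 3 [_]_⊢_∶_

data [_]_⊢_∶_ (Θ : TypeTheory ℓ) (Γ : Basis Θ) :
              Λ → TypeTheory.T Θ → Set ℓ where
  Ax   : ∀ {x A} → x ∶ A ∈ᴮ Γ → [ Θ ] Γ ⊢ free x ∶ A
  →I   : ∀ {x M A B} → [ Θ ] (Γ , x ∶ A) ⊢ M ∶ B →
         [ Θ ] Γ ⊢ ƛ x M ∶ A ⇒ B
  →E   : ∀ {M N A B} → [ Θ ] Γ ⊢ M ∶ A ⇒ B → [ Θ ] Γ ⊢ N ∶ A →
         [ Θ ] Γ ⊢ app M N ∶ B
  ∩I   : ∀ {M A B} → [ Θ ] Γ ⊢ M ∶ A → [ Θ ] Γ ⊢ M ∶ B →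
         [ Θ ] Γ ⊢ M ∶ A ∧ B
  sub  : ∀ {M A B} → [ Θ ] Γ ⊢ M ∶ A → TypeTheory._≤∇_ Θ A B →
         [ Θ ] Γ ⊢ M ∶ B
  Ax-Ω : ∀ {M} .(p : Ω ∈ TypeTheory.C Θ) → [ Θ ] Γ ⊢ M ∶ con Ω p
  Ax-ν : ∀ x M .(p : ν ∈ TypeTheory.C Θ) → [ Θ ] Γ ⊢ ƛ x M ∶ con ν p

------------------------------------------------------------------------
-- Semantics

-- Sets are setoids throughout: operations are congruent and subsets
-- are closed under the equality _≈_ of the setoid.

_[_≔_] : {D : Set ℓ} → (Var → D) → Var → D → (Var → D)
(ρ [ x ≔ d ]) y with x ≟ y
... | yes _ = d
... | no  _ = ρ y

record λ-ApplicativeStructure ℓ : Set (lsuc ℓ) where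
  field
    applicative : Magma ℓ ℓ

  open Magma applicative public renaming (Carrier to D; _∙_ to infixl 7 _·_)

  TermEnv : Set ℓ
  TermEnv = Var → D

  field
    ⟦_⟧    : Λ → TermEnv → D
    ⟦_⟧-cong : ∀ M {ρ ρ′} → (∀ x → ρ x ≈ ρ′ x) → ⟦ M ⟧ ρ ≈ ⟦ M ⟧ ρ′

  Subset : Set (lsuc ℓ)
  Subset = Σ[ P ∈ Pred D ℓ ] P Respects _≈_

  record GoodEnv (ρ : TermEnv) : Set ℓ where
    field
      var-good   : ∀ x → ⟦ free x ⟧ ρ ≈ ρ x
      nontrivial : ∃[ M ] ∃[ N ] ¬ (⟦ M ⟧ ρ ≈ ⟦ N ⟧ ρ)

record TypeInterpretationDomain ℓ : Set (lsuc ℓ) where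
  field
    structure : λ-ApplicativeStructure ℓ

  open λ-ApplicativeStructure structure public

  field
    Φ    : Subset
    lam∈Φ : ∀ x M ρ → ⟦ ƛ x M ⟧ ρ ∈ proj₁ Φ

module _ (Θ : TypeTheory ℓ) (I : TypeInterpretationDomain ℓ) where
  open TypeTheory Θ
  open TypeInterpretationDomain I

  -- The values of a type environment at Ω and ν are never used.

  TypeEnv : Set (lsuc ℓ)
  TypeEnv = (c : Constant Ψ) → .(c ∈ C) → Subset

  ⟦_⟧ᵀ : T → TypeEnv → Pred D ℓ
  ⟦ con Ω _     ⟧ᵀ V   = U
  ⟦ con ν _     ⟧ᵀ V   = proj₁ Φ
  ⟦ con (ψ k) p ⟧ᵀ V   = proj₁ (V (ψ k) p)
  ⟦ A ⇒ B       ⟧ᵀ V X = X ∈ proj₁ Φ × (∀ Y → Y ∈ ⟦ A ⟧ᵀ V → X · Y ∈ ⟦ B ⟧ᵀ V)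
  ⟦ A ∧ B       ⟧ᵀ V   = ⟦ A ⟧ᵀ V ∩ ⟦ B ⟧ᵀ V

  record ∇-Good (V : TypeEnv) : Set ℓ where
    field
      update-good : ∀ A {ρ} → GoodEnv ρ → ∀ x d → d ∈ ⟦ A ⟧ᵀ V →
                    GoodEnv (ρ [ x ≔ d ])
      lam-good    : ∀ A B {ρ} → GoodEnv ρ → ∀ M x →
                    (∀ d → d ∈ ⟦ A ⟧ᵀ V → ⟦ M ⟧ (ρ [ x ≔ d ]) ∈ ⟦ B ⟧ᵀ V) →
                    ⟦ ƛ x M ⟧ ρ ∈ ⟦ A ⇒ B ⟧ᵀ V

  Agrees : TypeEnv → Set ℓ
  Agrees V = ∀ {A B} → A ≤∇ B → ⟦ A ⟧ᵀ V ⊆ ⟦ B ⟧ᵀ V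

  Satisfies : TermEnv → TypeEnv → Λ → T → Set ℓ
  Satisfies ρ V M A = ⟦ M ⟧ ρ ∈ ⟦ A ⟧ᵀ V

  SatisfiesBasis : TermEnv → TypeEnv → Basis Θ → Set ℓ
  SatisfiesBasis ρ V Γ = ∀ {x B} → x ∶ B ∈ᴮ Γ → Satisfies ρ V (free x) B

infix 3 [_]_⊨ᵢ_∶_

[_]_⊨ᵢ_∶_ : (Θ : TypeTheory ℓ) → Basis Θ → Λ → TypeTheory.T Θ → Set (lsuc ℓ)
[_]_⊨ᵢ_∶_ {ℓ} Θ Γ M A =
  (I : TypeInterpretationDomain ℓ) (V : TypeEnv Θ I) →
  ∇-Good Θ I V → Agrees Θ I V →
  ∀ ρ → TypeInterpretationDomain.GoodEnv I ρ →
  SatisfiesBasis Θ I ρ V Γ → Satisfies Θ I ρ V M A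

{-# OPTIONS --safe #-}

-- Completeness is witnessed by one syntactic model.  Its elements denote
-- filters of types: the principal filters, the filters { A | Γ ⊢ x : A },
-- and closures (M , ρ), denoting the types of M when each variable x may be
-- given any type in the filter ρ x.  In this model d ∈ ⟦ A ⟧ iff A belongs to
-- the filter of d; the inclusion that needs an argument is the one for A ⇒ B,
-- obtained by applying d to the principal filter of A.  Interpreting x by
-- { A | Γ ⊢ x : A } then turns truth in the model into derivability from Γ.

module Submission where

open import Data.Bool.Base using (Bool; true; false)
open import Data.Empty using (⊥-elim-irr)
open import Data.List.Relation.Unary.All using ([]; _∷_)
open import Data.Nat.Base using (zero; suc)
open import Data.Nat.Properties using (_≟_)
open import Data.Product.Base using (_×_; _,_; proj₁; proj₂)
open import Data.Sum.Base using (_⊎_; inj₁; inj₂)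
open import Function.Base using (_∘_; id)
open import Level using (Level)
open import Relation.Binary.Core using (Rel)
open import Relation.Binary.PropositionalEquality.Core using (_≡_; _≢_; refl; sym; trans)
open import Relation.Nullary using (yes; no)
open import Relation.Unary using (Pred; _∈_; _⊆_; _≐_)
open import Relation.Unary.Properties using (≐-refl; ≐-sym; ≐-trans)

open import Defs

private
  variable
    ℓ : Level

-- The last field is vacuous for strict theories.

record ArrowLaws (Θ : TypeTheory ℓ) : Set ℓ where
  open TypeTheory Θ
  field
    ⇒-∧    : ∀ {A B D} → (A ⇒ B) ∧ (A ⇒ D) ≤∇ A ⇒ (B ∧ D)
    ⇒-mono : ∀ {A A′ B B′} → A′ ≤∇ A → B ≤∇ B′ → A ⇒ B ≤∇ A′ ⇒ B′
    ⇒-lazy : .(p : Ω ∈ C) → ∀ {A B} → A ⇒ B ≤∇ con Ω p ⇒ con Ω p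

arrowLaws : (Θ : TypeTheory ℓ) → Natural Θ ⊎ Strict Θ → ArrowLaws Θ
arrowLaws Θ (inj₁ nat) = record
  { ⇒-∧    = validates-→-∩ →-∩ []
  ; ⇒-mono = λ p q → validates-η η (p ∷ q ∷ [])
  ; ⇒-lazy = λ _ → validates-Ω-lazy Ω-lazy []
  }
  where open Natural nat
arrowLaws Θ (inj₂ str) = record
  { ⇒-∧    = validates-→-∩ →-∩ []
  ; ⇒-mono = λ p q → validates-η η (p ∷ q ∷ [])
  ; ⇒-lazy = λ p → ⊥-elim-irr (Ω∉C p)
  }
  where open Strict str

-- Filters of types and type assignment from contexts

module _ (Θ : TypeTheory ℓ) where
  open TypeTheory Θ

  ≤∇-refl : ∀ {A} → A ≤∇ A
  ≤∇-refl = infer (inj₁ ≤-refl) []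

  ≤∇-trans : ∀ {A B D} → A ≤∇ B → B ≤∇ D → A ≤∇ D
  ≤∇-trans p q = infer (inj₁ ≤-trans) (p ∷ q ∷ [])

  ∧-lowerˡ : ∀ {A B} → A ∧ B ≤∇ A
  ∧-lowerˡ = infer (inj₁ ∧-inclˡ) []

  ∧-lowerʳ : ∀ {A B} → A ∧ B ≤∇ B
  ∧-lowerʳ = infer (inj₁ ∧-inclʳ) []

  ∧-greatest : ∀ {A B D} → D ≤∇ A → D ≤∇ B → D ≤∇ A ∧ B
  ∧-greatest p q =
    ≤∇-trans (infer (inj₁ ≤-idem) []) (infer (inj₁ ∧-mono) (p ∷ q ∷ []))

  ≤∇-Ω : .(p : Ω ∈ C) → ∀ {A} → A ≤∇ con Ω p
  ≤∇-Ω p = infer (inj₂ (contains-Ω p Ω-top)) []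

  ⇒≤∇-ν : .(p : ν ∈ C) → ∀ {A B} → A ⇒ B ≤∇ con ν p
  ⇒≤∇-ν p = infer (inj₂ (contains-ν p ν-top)) []

  -- Only `Ω-mem` forces an element: without Ω a term may have no type, so the empty set must then
  -- count as a filter.
  record IsFilter (F : Pred T ℓ) : Set ℓ where
    field
      upward : ∀ {A B} → A ∈ F → A ≤∇ B → B ∈ F
      ∧-mem  : ∀ {A B} → A ∈ F → B ∈ F → A ∧ B ∈ F
      Ω-mem  : .(p : Ω ∈ C) → con Ω p ∈ F

  ↑ : T → Pred T ℓ
  ↑ A B = A ≤∇ B

  ↑-isFilter : ∀ A → IsFilter (↑ A)
  ↑-isFilter A = record
    { upward = ≤∇-trans ; ∧-mem = ∧-greatest ; Ω-mem = λ p → ≤∇-Ω p }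

  Context : Set _
  Context = Var → Pred T ℓ

  infix 4 _⊆ᶜ_

  _⊆ᶜ_ : Rel Context ℓ
  Δ ⊆ᶜ Δ′ = ∀ x → Δ x ⊆ Δ′ x

  update-mono : ∀ {Δ Δ′ : Context} → Δ ⊆ᶜ Δ′ → ∀ x {F} →
                (Δ [ x ≔ F ]) ⊆ᶜ (Δ′ [ x ≔ F ])
  update-mono Δ⊆Δ′ x y with x ≟ y
  ... | yes _ = id
  ... | no  _ = Δ⊆Δ′ y

  -- Type assignment from contexts giving a set of types to each variable.
  -- Unlike bases, two such contexts never have to be merged, so the types of
  -- a term form a filter by ∩I, sub and Ax-Ω alone.

  infix 3 _⊢_∶_

  data _⊢_∶_ (Δ : Context) : Λ → T → Set ℓ where
    Ax   : ∀ {x A} → A ∈ Δ x → Δ ⊢ free x ∶ A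
    →I   : ∀ {x M A B} → Δ [ x ≔ ↑ A ] ⊢ M ∶ B → Δ ⊢ ƛ x M ∶ A ⇒ B
    →E   : ∀ {M N A B} → Δ ⊢ M ∶ A ⇒ B → Δ ⊢ N ∶ A → Δ ⊢ app M N ∶ B
    ∩I   : ∀ {M A B} → Δ ⊢ M ∶ A → Δ ⊢ M ∶ B → Δ ⊢ M ∶ A ∧ B
    sub  : ∀ {M A B} → Δ ⊢ M ∶ A → A ≤∇ B → Δ ⊢ M ∶ B
    Ax-Ω : ∀ {M} .(p : Ω ∈ C) → Δ ⊢ M ∶ con Ω p
    Ax-ν : ∀ x M .(p : ν ∈ C) → Δ ⊢ ƛ x M ∶ con ν p

  ⊢-isFilter : ∀ Δ M → IsFilter (Δ ⊢ M ∶_)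
  ⊢-isFilter Δ M = record { upward = sub ; ∧-mem = ∩I ; Ω-mem = λ p → Ax-Ω p }

  ⊢-mono : ∀ {Δ Δ′ M A} → Δ ⊆ᶜ Δ′ → Δ ⊢ M ∶ A → Δ′ ⊢ M ∶ A
  ⊢-mono Δ⊆Δ′ (Ax a)       = Ax (Δ⊆Δ′ _ a)
  ⊢-mono Δ⊆Δ′ (→I {x} t)   = →I (⊢-mono (update-mono Δ⊆Δ′ x) t)
  ⊢-mono Δ⊆Δ′ (→E t u)     = →E (⊢-mono Δ⊆Δ′ t) (⊢-mono Δ⊆Δ′ u)
  ⊢-mono Δ⊆Δ′ (∩I t u)     = ∩I (⊢-mono Δ⊆Δ′ t) (⊢-mono Δ⊆Δ′ u)
  ⊢-mono Δ⊆Δ′ (sub t A≤B)  = sub (⊢-mono Δ⊆Δ′ t) A≤B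
  ⊢-mono Δ⊆Δ′ (Ax-Ω p)     = Ax-Ω p
  ⊢-mono Δ⊆Δ′ (Ax-ν x M p) = Ax-ν x M p

  -- Besides `Ax`, only `∩I`, `sub` and `Ax-Ω` can type a variable, and a filter is closed under
  -- each of these.
  free-inversion : ∀ {Δ x A} → IsFilter (Δ x) → Δ ⊢ free x ∶ A → A ∈ Δ x
  free-inversion f (Ax a)      = a
  free-inversion f (∩I t u)    =
    IsFilter.∧-mem f (free-inversion f t) (free-inversion f u)
  free-inversion f (sub t A≤B) = IsFilter.upward f (free-inversion f t) A≤B
  free-inversion f (Ax-Ω p)    = IsFilter.Ω-mem f p

  -- Without Ω ⇒ Ω ∈ Δ x, an application typed by Ax-Ω would say nothing
  -- about the function.

  app-inversion : ArrowLaws Θ → ∀ {Δ x y A B} →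
                  IsFilter (Δ x) → IsFilter (Δ y) → Δ y ⊆ ↑ A →
                  (.(p : Ω ∈ C) → con Ω p ⇒ con Ω p ∈ Δ x) →
                  Δ ⊢ app (free x) (free y) ∶ B → A ⇒ B ∈ Δ x
  app-inversion laws {Δ} {x} {y} {A} fx fy y⊆A Ω⇒Ω = go
    where
    open ArrowLaws laws
    open IsFilter fx
    go : ∀ {B} → Δ ⊢ app (free x) (free y) ∶ B → A ⇒ B ∈ Δ x
    go (→E t u)    = upward (free-inversion fx t)
                            (⇒-mono (y⊆A (free-inversion fy u)) ≤∇-refl)
    go (∩I t u)    = upward (∧-mem (go t) (go u)) ⇒-∧
    go (sub t B≤D) = upward (go t) (⇒-mono ≤∇-refl B≤D)
    go (Ax-Ω p)    = upward (Ω⇒Ω p) (⇒-mono (≤∇-Ω p) ≤∇-refl)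

-- From contexts back to bases

module _ {Θ : TypeTheory ℓ} where
  open TypeTheory Θ

  -- A derivation for a variable never extends the basis, so no renaming of bound variables arises.
  free-weaken : ∀ {Γ : Basis Θ} {x y A B} → y ≢ x →
                [ Θ ] Γ ⊢ free y ∶ B → [ Θ ] Γ , x ∶ A ⊢ free y ∶ B
  free-weaken y≢x (Ax a)      = Ax (inj₂ (y≢x , a))
  free-weaken y≢x (∩I t u)    = ∩I (free-weaken y≢x t) (free-weaken y≢x u)
  free-weaken y≢x (sub t A≤B) = sub (free-weaken y≢x t) A≤B
  free-weaken y≢x (Ax-Ω p)    = Ax-Ω p

  -- Under a binder the single statement `x ∶ A` suffices, since `sub` recovers every type in `↑ A`
  -- from it.
  ⊢⇒basis : ∀ {Γ : Basis Θ} {Δ M A} → (∀ x → Δ x ⊆ [ Θ ] Γ ⊢ free x ∶_) →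
            _⊢_∶_ Θ Δ M A → [ Θ ] Γ ⊢ M ∶ A
  ⊢⇒basis Δ⊆Γ (Ax a)       = Δ⊆Γ _ a
  ⊢⇒basis {Γ} {Δ} Δ⊆Γ (→I {x} {A = A} t) = →I (⊢⇒basis extended t)
    where
    extended : ∀ y → (Δ [ x ≔ ↑ Θ A ]) y ⊆ [ Θ ] Γ , x ∶ A ⊢ free y ∶_
    extended y with x ≟ y
    ... | yes x≡y = sub (Ax (inj₁ (sym x≡y , refl)))
    ... | no  x≢y = free-weaken (x≢y ∘ sym) ∘ Δ⊆Γ y
  ⊢⇒basis Δ⊆Γ (→E t u)     = →E (⊢⇒basis Δ⊆Γ t) (⊢⇒basis Δ⊆Γ u)
  ⊢⇒basis Δ⊆Γ (∩I t u)     = ∩I (⊢⇒basis Δ⊆Γ t) (⊢⇒basis Δ⊆Γ u)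
  ⊢⇒basis Δ⊆Γ (sub t A≤B)  = sub (⊢⇒basis Δ⊆Γ t) A≤B
  ⊢⇒basis Δ⊆Γ (Ax-Ω p)     = Ax-Ω p
  ⊢⇒basis Δ⊆Γ (Ax-ν x M p) = Ax-ν x M p

-- The syntactic filter model

module FilterModel (Θ : TypeTheory ℓ) (laws : ArrowLaws Θ) (Γ : Basis Θ) where
  open TypeTheory Θ
  open ArrowLaws laws

  -- Filters themselves live one universe too high to be the elements of a
  -- model, hence codes for the filters that are needed.

  data Code : Set ℓ where
    principal : T → Code
    basisVar  : Var → Code
    closure   : Λ → (Var → Code) → Code

  filter : Code → Pred T ℓ
  filter (principal A)   = ↑ Θ A
  filter (basisVar x)    = [ Θ ] Γ ⊢ free x ∶_
  filter (closure M ρ) A = _⊢_∶_ Θ (λ x → filter (ρ x)) M A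

  filter-isFilter : ∀ d → IsFilter Θ (filter d)
  filter-isFilter (principal A) = ↑-isFilter Θ A
  filter-isFilter (basisVar x)  =
    record { upward = sub ; ∧-mem = ∩I ; Ω-mem = λ p → Ax-Ω p }
  filter-isFilter (closure M ρ) = ⊢-isFilter Θ _ M

  module _ (d : Code) where
    open IsFilter (filter-isFilter d) public

  -- The filters of all terms may coincide (for instance when all types are
  -- equivalent), so a tag is added to keep environments nontrivial.

  tag : Code → Bool
  tag (principal A)         = false
  tag (basisVar x)          = false
  tag (closure (free x) ρ)  = tag (ρ x)
  tag (closure (app M N) ρ) = false
  tag (closure (lam M) ρ)   = true

  _≈_ : Rel Code ℓ
  d ≈ e = tag d ≡ tag e × filter d ≐ filter e

  closure-cong : ∀ M {ρ ρ′} → (∀ x → ρ x ≈ ρ′ x) → closure M ρ ≈ closure M ρ′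
  closure-cong M {ρ} {ρ′} ρ≈ρ′ = tags M ,
    ⊢-mono Θ (λ x → proj₁ (proj₂ (ρ≈ρ′ x))) ,
    ⊢-mono Θ (λ x → proj₂ (proj₂ (ρ≈ρ′ x)))
    where
    tags : ∀ M → tag (closure M ρ) ≡ tag (closure M ρ′)
    tags (free x)  = proj₁ (ρ≈ρ′ x)
    tags (app M N) = refl
    tags (lam M)   = refl

  operands : Code → Code → Var → Code
  operands d e zero    = d
  operands d e (suc _) = e

  -- As a closure, an application gets its filter properties and its congruence from those of
  -- closures.
  _·_ : Code → Code → Code
  d · e = closure (app (free 0) (free 1)) (operands d e)

  ·-cong : ∀ {d d′ e e′} → d ≈ d′ → e ≈ e′ → (d · e) ≈ (d′ · e′)
  ·-cong {d} {d′} {e} {e′} d≈d′ e≈e′ = closure-cong _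
    {operands d e} {operands d′ e′} λ { zero → d≈d′ ; (suc _) → e≈e′ }

  structure : λ-ApplicativeStructure ℓ
  structure = record
    { applicative = record
      { Carrier = Code
      ; _≈_     = _≈_
      ; _∙_     = _·_
      ; isMagma = record
        { isEquivalence = record
          { refl  = refl , ≐-refl
          ; sym   = λ (p , q) → sym p , ≐-sym q
          ; trans = λ (p , q) (p′ , q′) → trans p p′ , ≐-trans q q′
          }
        ; ∙-cong = ·-cong
        }
      }
    ; ⟦_⟧      = closure
    ; ⟦_⟧-cong = closure-cong
    }

  open λ-ApplicativeStructure structure using (Subset; GoodEnv)

  -- Without Ω and ν a λ-abstraction may have no type at all, so Φ must not be
  -- required to contain only filters with an arrow type.

  Φ : Subset
  Φ = (λ d → (.(p : Ω ∈ C) → con Ω p ⇒ con Ω p ∈ filter d) ×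
             (.(p : ν ∈ C) → con ν p ∈ filter d)) ,
      λ (_ , d⊆e , _) (Ω⇒Ω , ν′) → (λ p → d⊆e (Ω⇒Ω p)) , (λ p → d⊆e (ν′ p))

  domain : TypeInterpretationDomain ℓ
  domain = record
    { structure = structure
    ; Φ         = Φ
    ; lam∈Φ     = λ x M ρ → (λ p → →I {x = x} {M = M} (Ax-Ω p)) , (λ p → Ax-ν x M p)
    }

  V : TypeEnv Θ domain
  V c p = (λ d → con c p ∈ filter d) , λ (_ , d⊆e , _) → d⊆e

  ⟦_⟧ᵛ : T → Pred Code ℓ
  ⟦ A ⟧ᵛ = ⟦_⟧ᵀ Θ domain A V

  -- Simultaneous induction on the type: as `⇒` is contravariant, each direction needs the other at
  -- the domain.
  filter⇒⟦⟧ : ∀ A d → A ∈ filter d → d ∈ ⟦ A ⟧ᵛ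
  ⟦⟧⇒filter : ∀ A d → d ∈ ⟦ A ⟧ᵛ → A ∈ filter d

  filter⇒⟦⟧ (con Ω p)     d a = _
  -- With ν present Ω is absent, so the Ω condition in `Φ` is vacuous.
  filter⇒⟦⟧ (con ν p)     d a = (λ q → ⊥-elim-irr (not-both (q , p))) , λ _ → a
  filter⇒⟦⟧ (con (ψ k) p) d a = a
  filter⇒⟦⟧ (A ⇒ B)       d a =
    ((λ p → upward d a (⇒-lazy p)) , (λ p → upward d a (⇒≤∇-ν Θ p))) ,
    λ e e∈A → filter⇒⟦⟧ B (d · e) (→E (Ax a) (Ax (⟦⟧⇒filter A e e∈A)))
  filter⇒⟦⟧ (A ∧ B)       d a =
    filter⇒⟦⟧ A d (upward d a (∧-lowerˡ Θ)) ,
    filter⇒⟦⟧ B d (upward d a (∧-lowerʳ Θ))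

  ⟦⟧⇒filter (con Ω p)     d _         = Ω-mem d p
  ⟦⟧⇒filter (con ν p)     d (_ , ν′)  = ν′ p
  ⟦⟧⇒filter (con (ψ k) p) d a         = a
  ⟦⟧⇒filter (A ⇒ B)       d ((Ω⇒Ω , _) , maps) =
    -- `id` fits because the filter of `e` is `↑ A` itself; `Ω⇒Ω` comes from membership in `Φ`.
    app-inversion Θ laws (filter-isFilter d) (↑-isFilter Θ A) id Ω⇒Ω
      (⟦⟧⇒filter B (d · e) (maps e (filter⇒⟦⟧ A e (≤∇-refl Θ))))
    where
    e = principal A
  ⟦⟧⇒filter (A ∧ B)       d (a , b)   =
    ∧-mem d (⟦⟧⇒filter A d a) (⟦⟧⇒filter B d b)

  goodEnv : ∀ ρ → GoodEnv ρ
  goodEnv ρ = record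
    { var-good   = λ x → refl , free-inversion Θ (filter-isFilter (ρ x)) , Ax
    -- The tags of these two terms differ in every environment.
    ; nontrivial = app (free 0) (free 0) , lam (free 0) , λ ()
    }

  agrees : Agrees Θ domain V
  agrees {A} {B} A≤B {d} d∈A =
    filter⇒⟦⟧ B d (upward d (⟦⟧⇒filter A d d∈A) A≤B)

  ∇-good : ∇-Good Θ domain V
  ∇-good = record
    { update-good = λ _ _ _ _ _ → goodEnv _
    ; lam-good    = λ A B {ρ} _ M x maps →
        filter⇒⟦⟧ (A ⇒ B) _
          -- The hypothesis at `principal A` is already the premise of `→I`.
          (→I (⊢-mono Θ (update-filter ρ x A)
            (⟦⟧⇒filter B _ (maps (principal A) (filter⇒⟦⟧ A _ (≤∇-refl Θ))))))
    }
    where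
    update-filter : ∀ ρ x A → _⊆ᶜ_ Θ (filter ∘ (ρ [ x ≔ principal A ]))
                                      ((filter ∘ ρ) [ x ≔ ↑ Θ A ])
    update-filter ρ x A y with x ≟ y
    ... | yes _ = id
    ... | no  _ = id

  satisfiesBasis : SatisfiesBasis Θ domain basisVar V Γ
  -- The outer `Ax` reads the context of filters, the inner one the basis `Γ`.
  satisfiesBasis {x} {B} x∶B∈Γ = filter⇒⟦⟧ B (closure (free x) basisVar) (Ax (Ax x∶B∈Γ))

  complete : ∀ M A → [ Θ ] Γ ⊨ᵢ M ∶ A → [ Θ ] Γ ⊢ M ∶ A
  complete M A Γ⊨M∶A = ⊢⇒basis (λ x → id) (⟦⟧⇒filter A (closure M basisVar)
    (Γ⊨M∶A domain V ∇-good agrees basisVar (goodEnv basisVar) satisfiesBasis))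

theorem5p15 : ∀ {ℓ} (Θ : TypeTheory ℓ) → Natural Θ ⊎ Strict Θ →
    (Γ : Basis Θ) (M : Λ) (A : TypeTheory.T Θ) →
    [ Θ ] Γ ⊨ᵢ M ∶ A → [ Θ ] Γ ⊢ M ∶ A
theorem5p15 Θ natural⊎strict Γ = FilterModel.complete Θ (arrowLaws Θ natural⊎strict) Γ
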